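{- Let $l\geq 4$ be an integer and let $\Sigma=\{L_1,\dots,L_n\}$ be a finite family of mutually skew lines in $\mathbb{R}^l$ such that the three dimensional affine hull of every two lines in $\Sigma$ contains at least one more line of $\Sigma$. Let $H_1,\dots,H_m$ be the distinct three dimensional affine hulls of pairs of distinct lines of $\Sigma$, and suppose $m\geq 2$. If there is a point $O\in\bigcap_{i=1}^m H_i$, then there exists a line $L\subset\mathbb{R}^l$ passing through $O$, different from each $L_i$, such that $L_i$ and $L$ are coplanar for each $1\leq i\leq n$.
   Context: Two lines in $\mathbb{R}^l$ are skew if they are neither intersecting nor parallel, equivalently their affine hull (smallest affine subspace containing both) is three dimensional. Mutually skew means pairwise skew. Two lines are coplanar if they lie in a common two dimensional affine plane. -}

module Defs where

open import Data.Nat using (ℕ; zero; suc)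
open import Data.Fin using (Fin; zero; suc)
open import Data.Product using (Σ; ∃; ∃-syntax; _×_; _,_)
open import Data.Sum using (_⊎_)
open import Relation.Nullary using (¬_)
open import Relation.Binary.PropositionalEquality using (_≡_)

-- The real numbers, axiomatised as a complete ordered field
-- (all models are isomorphic to ℝ).
record RealField : Set₁ where
  infixl 6 _+_
  infixl 7 _*_
  infix 4 _<_
  field
    ℝ : Set
    0ℝ 1ℝ : ℝ
    _+_ _*_ : ℝ → ℝ → ℝ
    -_ : ℝ → ℝ
    _<_ : ℝ → ℝ → Set
    +-assoc : ∀ x y z → (x + y) + z ≡ x + (y + z)
    +-comm : ∀ x y → x + y ≡ y + x
    +-identityˡ : ∀ x → 0ℝ + x ≡ x
    +-inverseˡ : ∀ x → (- x) + x ≡ 0ℝ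
    *-assoc : ∀ x y z → (x * y) * z ≡ x * (y * z)
    *-comm : ∀ x y → x * y ≡ y * x
    *-identityˡ : ∀ x → 1ℝ * x ≡ x
    *-inverse : ∀ x → ¬ x ≡ 0ℝ → ∃[ y ] (y * x ≡ 1ℝ)
    distribˡ : ∀ x y z → x * (y + z) ≡ x * y + x * z
    0≢1 : ¬ 0ℝ ≡ 1ℝ
    <-irrefl : ∀ x → ¬ x < x
    <-trans : ∀ x y z → x < y → y < z → x < z
    <-trichotomy : ∀ x y → x < y ⊎ (x ≡ y ⊎ y < x)
    +-mono-< : ∀ x y z → x < y → x + z < y + z
    *-pos : ∀ x y → 0ℝ < x → 0ℝ < y → 0ℝ < x * y
    sup : (P : ℝ → Set) → ∃ P → (∃[ b ] (∀ x → P x → ¬ b < x)) →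
          ∃[ s ] ((∀ x → P x → ¬ s < x) × (∀ b → (∀ x → P x → ¬ b < x) → ¬ b < s))

module Geometry (R : RealField) (l : ℕ) where
  open RealField R

  Point : Set
  Point = Fin l → ℝ

  _≈_ : Point → Point → Set
  x ≈ y = ∀ i → x i ≡ y i

  _⊕_ : Point → Point → Point
  (x ⊕ y) i = x i + y i

  _·_ : ℝ → Point → Point
  (c · x) i = c * x i

  𝟎 : Point
  𝟎 i = 0ℝ

  record Line : Set where
    constructor line
    field
      base : Point
      dir : Point
      dir≢0 : ¬ (dir ≈ 𝟎)
  open Line public

  OnLine : Line → Point → Set
  OnLine L x = ∃[ t ] (x ≈ (base L ⊕ (t · dir L)))

  PointSet : Set₁
  PointSet = Point → Set

  _⊆_ : PointSet → PointSet → Set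
  S ⊆ T = ∀ x → S x → T x

  _≐_ : PointSet → PointSet → Set
  S ≐ T = (S ⊆ T) × (T ⊆ S)

  Intersecting : Line → Line → Set
  Intersecting L M = ∃[ x ] (OnLine L x × OnLine M x)

  Parallel : Line → Line → Set
  Parallel L M = ∃[ c ] (dir L ≈ (c · dir M))

  Skew : Line → Line → Set
  Skew L M = ¬ Intersecting L M × ¬ Parallel L M

  sumℝ : ∀ {k} → (Fin k → ℝ) → ℝ
  sumℝ {zero} w = 0ℝ
  sumℝ {suc k} w = w zero + sumℝ (λ j → w (suc j))

  sumP : ∀ {k} → (Fin k → Point) → Point
  sumP {zero} v = 𝟎
  sumP {suc k} v = v zero ⊕ sumP (λ j → v (suc j))

  AffineHull : Line → Line → PointSet
  AffineHull L M x =
    Σ ℕ λ k → Σ (Fin k → Point) λ ys → Σ (Fin k → ℝ) λ w →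
      (∀ j → OnLine L (ys j) ⊎ OnLine M (ys j)) ×
      (sumℝ w ≡ 1ℝ) ×
      (x ≈ sumP (λ j → w j · ys j))

  LinIndep₂ : Point → Point → Set
  LinIndep₂ a b = ∀ s t → ((s · a) ⊕ (t · b)) ≈ 𝟎 → (s ≡ 0ℝ) × (t ≡ 0ℝ)

  Plane : Point → Point → Point → PointSet
  Plane p a b x = ∃[ s ] ∃[ t ] (x ≈ ((p ⊕ (s · a)) ⊕ (t · b)))

  Coplanar : Line → Line → Set
  Coplanar L M = ∃[ p ] ∃[ a ] ∃[ b ]
    (LinIndep₂ a b × (OnLine L ⊆ Plane p a b) × (OnLine M ⊆ Plane p a b))

{-# OPTIONS --safe #-}

-- Call the span of L − O, translated to the origin, the cone of a line L; it is a plane unless O ∈ L, which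
-- happens for at most one L. As O lies on every hull, that hull is O plus the sum of two cones, and two cones that
-- are planes meet in a line through the origin. Hence, for two lines missing O whose cones meet in the span of v,
-- every further cone that is a plane either contains v or lies in the sum of the two. If all contain v, the line
-- O + ℝ v is as required. Otherwise a cone avoiding v forces all cones into one sum (a line through O is
-- reached by means of the third line in a hull), and then all hulls coincide.

module Submission where

open import Algebra.Bundles using (CommutativeRing)
import Algebra.Consequences.Propositional as Consequences
import Algebra.Properties.AbelianGroup as AbelianGroupProperties
import Algebra.Properties.Ring as RingProperties
import Algebra.Properties.Semiring.Mult.TCOptimised as Mult
import Algebra.Solver.Ring as RingSolver
open import Algebra.Solver.Ring.AlmostCommutativeRing
  using (AlmostCommutativeRing; fromCommutativeRing; _-Raw-AlmostCommutative⟶_)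
open import Data.Fin as Fin using (Fin; zero; suc)
import Data.Fin.Properties as Fin
open import Data.Integer as ℤ using (ℤ; -[1+_]; _⊖_) renaming (+_ to pos)
import Data.Integer.Properties as ℤ
open import Data.Maybe using (Maybe; just; nothing)
open import Data.Nat as ℕ using (ℕ; zero; suc; _≤_)
import Data.Nat.Properties as ℕ
open import Data.Product using (Σ; ∃; ∃-syntax; _×_; _,_; _,′_; proj₁; proj₂)
open import Data.Sum using (_⊎_; inj₁; inj₂; [_,_]′)
open import Defs
open import Function using (case_of_)
open import Level using (0ℓ)
open import Relation.Binary.PropositionalEquality
  using (_≡_; _≢_; refl; sym; trans; cong; cong₂; isEquivalence; ≢-sym; module ≡-Reasoning)
open import Relation.Nullary using (¬_; Dec; yes; no; contradiction)

-- Finiteness of the index makes this choice constructive. At the end it separates a vector common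
-- to the cones from an explicit exceptional line.
all-or-any : ∀ {n} {A B : Fin n → Set} → (∀ i → A i ⊎ B i) → (∀ i → A i) ⊎ ∃ B
all-or-any {zero}  f = inj₁ λ ()
all-or-any {suc n} f with f zero | all-or-any (λ i → f (suc i))
... | inj₂ b | _            = inj₂ (zero , b)
... | inj₁ _ | inj₂ (i , b) = inj₂ (suc i , b)
... | inj₁ a | inj₁ as      = inj₁ λ { zero → a ; (suc i) → as i }

-- The real field as a commutative ring, with a ring solver over the integers.

module RealAlgebra (R : RealField) where
  open RealField R

  commutativeRing : CommutativeRing 0ℓ 0ℓ
  commutativeRing = record
    { Carrier = ℝ ; _≈_ = _≡_ ; _+_ = _+_ ; _*_ = _*_ ; -_ = -_ ; 0# = 0ℝ ; 1# = 1ℝ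
    ; isCommutativeRing = record
      { isRing = record
        { +-isAbelianGroup = record
          { isGroup = record
            { isMonoid = record
              { isSemigroup = record
                { isMagma = record { isEquivalence = isEquivalence ; ∙-cong = cong₂ _+_ }
                ; assoc = +-assoc }
              ; identity = comm∧idˡ⇒id +-comm +-identityˡ }
            ; inverse = comm∧invˡ⇒inv +-comm +-inverseˡ
            ; ⁻¹-cong = cong -_ }
          ; comm = +-comm }
        ; *-cong = cong₂ _*_
        ; *-assoc = *-assoc
        ; *-identity = comm∧idˡ⇒id *-comm *-identityˡ
        ; distrib = distribˡ , comm∧distrˡ⇒distrʳ *-comm distribˡ }
      ; *-comm = *-comm } }
    where open Consequences

  open CommutativeRing commutativeRing public
    using (ring; semiring; +-abelianGroup; +-congˡ; +-congʳ; +-identityʳ; *-identityʳ; -‿inverseʳ; zeroˡ; zeroʳ)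
  open RingProperties ring public using (-0#≈0#; -‿involutive; -‿distribˡ-*; -‿distribʳ-*)
  open AbelianGroupProperties +-abelianGroup using (⁻¹-∙-comm)
  open Mult semiring renaming (_×_ to _×ℕ_)

  -- Integers serve as solver coefficients because their equality is decided by computation. The
  -- optimised multiple reduces 1 times x to x, so the solver constants 0 and 1 denote `0ℝ` and `1ℝ`
  -- by definition.
  fromℤ : ℤ → ℝ
  fromℤ (pos n)  = n ×ℕ 1ℝ
  fromℤ -[1+ n ] = - (suc n ×ℕ 1ℝ)

  fromℤ-neg : ∀ i → fromℤ (ℤ.- i) ≡ - fromℤ i
  fromℤ-neg (pos zero)    = sym -0#≈0#
  fromℤ-neg (pos (suc n)) = refl
  fromℤ-neg -[1+ n ]      = sym (-‿involutive _)

  x+y-[x+z] : ∀ x y z → (x + y) + - (x + z) ≡ y + - z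
  x+y-[x+z] x y z = begin
    (x + y) + - (x + z)   ≡⟨ cong₂ _+_ (+-comm x y) (sym (⁻¹-∙-comm x z)) ⟩
    (y + x) + (- x + - z) ≡⟨ +-assoc y x _ ⟩
    y + (x + (- x + - z)) ≡⟨ cong (y +_) (sym (+-assoc x (- x) (- z))) ⟩
    y + ((x + - x) + - z) ≡⟨ cong (λ w → y + (w + - z)) (-‿inverseʳ x) ⟩
    y + (0ℝ + - z)        ≡⟨ cong (y +_) (+-identityˡ (- z)) ⟩
    y + - z               ∎
    where open ≡-Reasoning

  -- The recursion lowers both arguments at once; the `1ℝ` that each contributes cancels.
  fromℤ-⊖ : ∀ m n → fromℤ (m ⊖ n) ≡ m ×ℕ 1ℝ + - (n ×ℕ 1ℝ)
  fromℤ-⊖ m       zero    = sym (trans (cong (m ×ℕ 1ℝ +_) -0#≈0#) (+-identityʳ _))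
  fromℤ-⊖ zero    (suc n) = sym (+-identityˡ _)
  fromℤ-⊖ (suc m) (suc n) = begin
    fromℤ (suc m ⊖ suc n)             ≡⟨ cong fromℤ (ℤ.[1+m]⊖[1+n]≡m⊖n m n) ⟩
    fromℤ (m ⊖ n)                     ≡⟨ fromℤ-⊖ m n ⟩
    m ×ℕ 1ℝ + - (n ×ℕ 1ℝ)             ≡⟨ x+y-[x+z] 1ℝ _ _ ⟨
    (1ℝ + m ×ℕ 1ℝ) + - (1ℝ + n ×ℕ 1ℝ) ≡⟨ cong₂ (λ x y → x + - y) (1+× m 1ℝ) (1+× n 1ℝ) ⟨
    suc m ×ℕ 1ℝ + - (suc n ×ℕ 1ℝ)     ∎
    where open ≡-Reasoning

  fromℤ-+ : ∀ i j → fromℤ (i ℤ.+ j) ≡ fromℤ i + fromℤ j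
  fromℤ-+ (pos m)  (pos n)  = ×-homo-+ 1ℝ m n
  fromℤ-+ (pos m)  -[1+ n ] = fromℤ-⊖ m (suc n)
  fromℤ-+ -[1+ m ] (pos n)  = trans (fromℤ-⊖ n (suc m)) (+-comm _ _)
  fromℤ-+ -[1+ m ] -[1+ n ] = begin
    - (suc (suc (m ℕ.+ n)) ×ℕ 1ℝ)     ≡⟨ cong (λ k → - (k ×ℕ 1ℝ)) (sym (ℕ.+-suc (suc m) n)) ⟩
    - ((suc m ℕ.+ suc n) ×ℕ 1ℝ)       ≡⟨ cong -_ (×-homo-+ 1ℝ (suc m) (suc n)) ⟩
    - (suc m ×ℕ 1ℝ + suc n ×ℕ 1ℝ)     ≡⟨ ⁻¹-∙-comm _ _ ⟨
    - (suc m ×ℕ 1ℝ) + - (suc n ×ℕ 1ℝ) ∎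
    where open ≡-Reasoning

  fromℤ-*-pos : ∀ m j → fromℤ (pos m ℤ.* j) ≡ fromℤ (pos m) * fromℤ j
  fromℤ-*-pos m (pos n)  = trans (cong fromℤ (sym (ℤ.pos-* m n))) (×1-homo-* m n)
  fromℤ-*-pos m -[1+ n ] = begin
    fromℤ (pos m ℤ.* -[1+ n ])              ≡⟨ cong fromℤ (ℤ.neg-distribʳ-* (pos m) (pos (suc n))) ⟨
    fromℤ (ℤ.- (pos m ℤ.* pos (suc n)))     ≡⟨ fromℤ-neg (pos m ℤ.* pos (suc n)) ⟩
    - fromℤ (pos m ℤ.* pos (suc n))         ≡⟨ cong -_ (fromℤ-*-pos m (pos (suc n))) ⟩
    - (fromℤ (pos m) * fromℤ (pos (suc n))) ≡⟨ -‿distribʳ-* _ _ ⟩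
    fromℤ (pos m) * - fromℤ (pos (suc n))   ∎
    where open ≡-Reasoning

  fromℤ-* : ∀ i j → fromℤ (i ℤ.* j) ≡ fromℤ i * fromℤ j
  fromℤ-* (pos m)  j = fromℤ-*-pos m j
  fromℤ-* -[1+ m ] j = begin
    fromℤ (-[1+ m ] ℤ.* j)            ≡⟨ cong fromℤ (ℤ.neg-distribˡ-* (pos (suc m)) j) ⟨
    fromℤ (ℤ.- (pos (suc m) ℤ.* j))   ≡⟨ fromℤ-neg (pos (suc m) ℤ.* j) ⟩
    - fromℤ (pos (suc m) ℤ.* j)       ≡⟨ cong -_ (fromℤ-*-pos (suc m) j) ⟩
    - (fromℤ (pos (suc m)) * fromℤ j) ≡⟨ -‿distribˡ-* _ _ ⟩
    - fromℤ (pos (suc m)) * fromℤ j   ∎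
    where open ≡-Reasoning

  almostCommutativeRing : AlmostCommutativeRing 0ℓ 0ℓ
  almostCommutativeRing = fromCommutativeRing commutativeRing

  morphism : ℤ.+-*-rawRing -Raw-AlmostCommutative⟶ almostCommutativeRing
  morphism = record
    { ⟦_⟧ = fromℤ ; +-homo = fromℤ-+ ; *-homo = fromℤ-* ; -‿homo = fromℤ-neg
    ; 0-homo = refl ; 1-homo = refl }

  coeff≟ : ∀ i j → Maybe (fromℤ i ≡ fromℤ j)
  coeff≟ i j with i ℤ.≟ j
  ... | yes i≡j = just (cong fromℤ i≡j)
  ... | no _    = nothing

  open RingSolver ℤ.+-*-rawRing almostCommutativeRing morphism coeff≟ public
    using (solve; con; _:=_; _:+_; _:*_; :-_)

  -- Trichotomy decides equality without excluded middle; the case splits on vanishing coefficients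
  -- and determinants rest on this.
  _≟_ : ∀ x y → Dec (x ≡ y)
  x ≟ y with <-trichotomy x y
  ... | inj₁ x<y        = no λ { refl → <-irrefl x x<y }
  ... | inj₂ (inj₁ x≡y) = yes x≡y
  ... | inj₂ (inj₂ y<x) = no λ { refl → <-irrefl x y<x }

  *-cancelˡ-0 : ∀ {c x} → c ≢ 0ℝ → c * x ≡ 0ℝ → x ≡ 0ℝ
  *-cancelˡ-0 {c} {x} c≢0 cx≡0 with *-inverse c c≢0
  ... | i , ic≡1 = begin
    x           ≡⟨ *-identityˡ x ⟨
    1ℝ * x      ≡⟨ cong (_* x) ic≡1 ⟨
    i * c * x   ≡⟨ *-assoc i c x ⟩
    i * (c * x) ≡⟨ cong (i *_) cx≡0 ⟩
    i * 0ℝ      ≡⟨ zeroʳ i ⟩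
    0ℝ          ∎
    where open ≡-Reasoning

-- Subspaces, spans and sums of subspaces.

module LinearAlgebra (R : RealField) (l : ℕ) where
  open RealField R
  open RealAlgebra R
  open Geometry R l

  -- Proves p ≡ q from hypotheses a ≡ b: the difference p − q is exhibited as a combination of the differences
  -- a − b, which leaves a ring identity.
  combine : ∀ {p q a b} c → a ≡ b → p ≡ q + c * (a + - b) → p ≡ q
  combine {q = q} {a} c refl p≡ = trans p≡
    (solve 3 (λ q a c → q :+ c :* (a :+ :- a) := q) refl q a c)

  _∔_ : PointSet → PointSet → PointSet
  (S ∔ T) x = ∃[ y ] ∃[ z ] (S y × T z × x ≈ (y ⊕ z))

  Span : Point → Point → PointSet
  Span a d x = ∃[ s ] ∃[ t ] (x ≈ ((s · a) ⊕ (t · d)))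

  -- Points are functions compared coordinatewise by `≈`, which is weaker than propositional
  -- equality, so invariance under `≈` is a closure condition of its own.
  record IsSubspace (S : PointSet) : Set where
    field
      resp   : ∀ {x y} → x ≈ y → S y → S x
      origin : S 𝟎
      add    : ∀ {x y} → S x → S y → S (x ⊕ y)
      scale  : ∀ {x} c → S x → S (c · x)
  open IsSubspace

  span-isSubspace : ∀ a d → IsSubspace (Span a d)
  span-isSubspace a d = record
    { resp   = λ { x≈y (s , t , e) → s , t , λ k → trans (x≈y k) (e k) }
    ; origin = 0ℝ , 0ℝ , λ k →
        solve 2 (λ a d → con (pos 0) := con (pos 0) :* a :+ con (pos 0) :* d) refl (a k) (d k)
    ; add    = λ { (s , t , e) (s′ , t′ , e′) → s + s′ , t + t′ , λ k →
        trans (cong₂ _+_ (e k) (e′ k))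
          (solve 6 (λ a d s t s′ t′ → (s :* a :+ t :* d) :+ (s′ :* a :+ t′ :* d)
                                    := (s :+ s′) :* a :+ (t :+ t′) :* d)
            refl (a k) (d k) s t s′ t′) }
    ; scale  = λ { c (s , t , e) → c * s , c * t , λ k →
        trans (cong (c *_) (e k))
          (solve 5 (λ a d s t c → c :* (s :* a :+ t :* d) := c :* s :* a :+ c :* t :* d)
            refl (a k) (d k) s t c) }
    }

  ∔-isSubspace : ∀ {S T} → IsSubspace S → IsSubspace T → IsSubspace (S ∔ T)
  ∔-isSubspace S T = record
    { resp   = λ { x≈y (u , v , Su , Tv , e) → u , v , Su , Tv , λ k → trans (x≈y k) (e k) }
    ; origin = 𝟎 , 𝟎 , origin S , origin T , λ k → sym (+-identityˡ 0ℝ)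
    ; add    = λ { (u , v , Su , Tv , e) (u′ , v′ , Su′ , Tv′ , e′) →
        u ⊕ u′ , v ⊕ v′ , add S Su Su′ , add T Tv Tv′ , λ k →
        trans (cong₂ _+_ (e k) (e′ k))
          (solve 4 (λ u v u′ v′ → (u :+ v) :+ (u′ :+ v′) := (u :+ u′) :+ (v :+ v′))
            refl (u k) (v k) (u′ k) (v′ k)) }
    ; scale  = λ { c (u , v , Su , Tv , e) → c · u , c · v , scale S c Su , scale T c Tv , λ k →
        trans (cong (c *_) (e k)) (distribˡ c (u k) (v k)) }
    }

  span-⊆ : ∀ {S a d} → IsSubspace S → S a → S d → Span a d ⊆ S
  span-⊆ S Sa Sd x (s , t , e) = resp S e (add S (scale S s Sa) (scale S t Sd))

  ∔-⊆ : ∀ {S T U} → IsSubspace U → S ⊆ U → T ⊆ U → (S ∔ T) ⊆ U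
  ∔-⊆ U S⊆U T⊆U x (u , v , Su , Tv , e) = resp U e (add U (S⊆U u Su) (T⊆U v Tv))

  ⊆-∔ˡ : ∀ {S T} → IsSubspace T → S ⊆ (S ∔ T)
  ⊆-∔ˡ T x Sx = x , 𝟎 , Sx , origin T , λ k → sym (+-identityʳ (x k))

  ⊆-∔ʳ : ∀ {S T} → IsSubspace S → T ⊆ (S ∔ T)
  ⊆-∔ʳ S x Tx = 𝟎 , x , origin S , Tx , λ k → sym (+-identityˡ (x k))

  span-left : ∀ a d → Span a d a
  span-left a d = 1ℝ , 0ℝ , λ k →
    solve 2 (λ a d → a := con (pos 1) :* a :+ con (pos 0) :* d) refl (a k) (d k)

  span-right : ∀ a d → Span a d d
  span-right a d = 0ℝ , 1ℝ , λ k →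
    solve 2 (λ a d → d := con (pos 0) :* a :+ con (pos 1) :* d) refl (a k) (d k)

  cancel-summand : ∀ {S x u z} c → IsSubspace S → c ≢ 0ℝ →
                   S x → S u → x ≈ (u ⊕ (c · z)) → S z
  cancel-summand {x = x} {u} {z} c S c≢0 Sx Su x≈ with *-inverse c c≢0
  ... | i , ic≡1 = resp S z≈ (scale S i (add S Sx (scale S (- 1ℝ) Su)))
    where
    z≈ : z ≈ (i · (x ⊕ ((- 1ℝ) · u)))
    z≈ k = combine (- i) (x≈ k) (combine (- z k) ic≡1
      (solve 5 (λ c i x u z →
          z := (i :* (x :+ (:- con (pos 1)) :* u) :+ (:- i) :* (x :+ :- (u :+ c :* z)))
               :+ (:- z) :* (i :* c :+ :- con (pos 1)))
        refl c i (x k) (u k) (z k)))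

  Multiple : Point → PointSet
  Multiple z x = ∃[ c ] (x ≈ (c · z))

  multiple-isSubspace : ∀ z → IsSubspace (Multiple z)
  multiple-isSubspace z = record
    { resp   = λ { x≈y (c , e) → c , λ k → trans (x≈y k) (e k) }
    ; origin = 0ℝ , λ k → sym (zeroˡ (z k))
    ; add    = λ { (c , e) (c′ , e′) → c + c′ , λ k → trans (cong₂ _+_ (e k) (e′ k))
        (solve 3 (λ c c′ z → c :* z :+ c′ :* z := (c :+ c′) :* z) refl c c′ (z k)) }
    ; scale  = λ { a (c , e) → a * c , λ k →
        trans (cong (a *_) (e k)) (sym (*-assoc a c (z k))) }
    }

  multiple-self : ∀ z → Multiple z z
  multiple-self z = 1ℝ , λ k → sym (*-identityˡ (z k))

  multiple-⊆ : ∀ {S z} → IsSubspace S → S z → Multiple z ⊆ S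
  multiple-⊆ S Sz x (c , e) = resp S e (scale S c Sz)

  multiple-sym : ∀ {v z} → ¬ v ≈ 𝟎 → Multiple z v → Multiple v z
  multiple-sym {v} {z} v≉0 (c , e) with c ≟ 0ℝ
  ... | yes refl = contradiction (λ k → trans (e k) (zeroˡ (z k))) v≉0
  ... | no c≢0   = cancel-summand c (multiple-isSubspace v) c≢0 (multiple-self v)
          (origin (multiple-isSubspace v)) (λ k → trans (e k) (sym (+-identityˡ _)))

  -- The point x is u + c z with u in S. For c nonzero this is solved for z; for c = 0 the z-part
  -- disappears. This is the core of the exchange argument.
  recover-or-drop : ∀ {S T x z} → IsSubspace S → IsSubspace T → S ⊆ T →
                    T x → (S ∔ Multiple z) x → T z ⊎ S x
  recover-or-drop S T S⊆T Tx (u , w , Su , (c , w≈) , x≈) with c ≟ 0ℝ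
  ... | no c≢0   = inj₁ (cancel-summand c T c≢0 Tx (S⊆T u Su)
          (λ k → trans (x≈ k) (+-congˡ (w≈ k))))
  ... | yes refl = inj₂ (resp S (λ k → trans (x≈ k)
          (trans (+-congˡ (trans (w≈ k) (zeroˡ _))) (+-identityʳ (u k)))) Su)

  -- Two vectors in the span of two others.

  module _ {a d x y : Point} where

    -- Cramer's rule: with D the determinant, a = (y₂ x - x₂ y) / D and d = (x₁ y - y₁ x) / D.
    spanning : ∀ x₁ x₂ y₁ y₂ → x ≈ ((x₁ · a) ⊕ (x₂ · d)) → y ≈ ((y₁ · a) ⊕ (y₂ · d)) →
               x₁ * y₂ + - (x₂ * y₁) ≢ 0ℝ → Span x y a × Span x y d
    spanning x₁ x₂ y₁ y₂ x≈ y≈ D≢0 with *-inverse _ D≢0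
    ... | i , iD≡1 =
      (i * y₂ , - (i * x₂) , λ k → combine (- (i * y₂)) (x≈ k) (combine (i * x₂) (y≈ k)
        (combine (- a k) iD≡1
        (solve 9 (λ a d x y x₁ x₂ y₁ y₂ i →
            a := (((i :* y₂ :* x :+ (:- (i :* x₂)) :* y)
                 :+ (:- (i :* y₂)) :* (x :+ :- (x₁ :* a :+ x₂ :* d)))
                 :+ i :* x₂ :* (y :+ :- (y₁ :* a :+ y₂ :* d)))
                 :+ (:- a) :* (i :* (x₁ :* y₂ :+ :- (x₂ :* y₁)) :+ :- con (pos 1)))
          refl (a k) (d k) (x k) (y k) x₁ x₂ y₁ y₂ i)))) ,
      (- (i * y₁) , i * x₁ , λ k → combine (i * y₁) (x≈ k) (combine (- (i * x₁)) (y≈ k)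
        (combine (- d k) iD≡1
        (solve 9 (λ a d x y x₁ x₂ y₁ y₂ i →
            d := ((((:- (i :* y₁)) :* x :+ i :* x₁ :* y)
                 :+ i :* y₁ :* (x :+ :- (x₁ :* a :+ x₂ :* d)))
                 :+ (:- (i :* x₁)) :* (y :+ :- (y₁ :* a :+ y₂ :* d)))
                 :+ (:- d) :* (i :* (x₁ :* y₂ :+ :- (x₂ :* y₁)) :+ :- con (pos 1)))
          refl (a k) (d k) (x k) (y k) x₁ x₂ y₁ y₂ i))))

    -- With zero determinant, comparing first coefficients leaves y = (y₁ / x₁) x.
    proportional : ∀ x₁ x₂ y₁ y₂ → x ≈ ((x₁ · a) ⊕ (x₂ · d)) → y ≈ ((y₁ · a) ⊕ (y₂ · d)) →
                   x₁ * y₂ + - (x₂ * y₁) ≡ 0ℝ → x₁ ≢ 0ℝ → Multiple x y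
    proportional x₁ x₂ y₁ y₂ x≈ y≈ D≡0 x₁≢0 with *-inverse x₁ x₁≢0
    ... | i , ix₁≡1 = i * y₁ , λ k → combine 1ℝ (y≈ k) (combine (- (i * y₁)) (x≈ k)
      (combine (- (y₁ * a k + y₂ * d k)) ix₁≡1 (combine (i * d k) D≡0
      (solve 9 (λ a d x y x₁ x₂ y₁ y₂ i →
          y := ((((i :* y₁ :* x)
               :+ con (pos 1) :* (y :+ :- (y₁ :* a :+ y₂ :* d)))
               :+ (:- (i :* y₁)) :* (x :+ :- (x₁ :* a :+ x₂ :* d)))
               :+ (:- (y₁ :* a :+ y₂ :* d)) :* (i :* x₁ :+ :- con (pos 1)))
               :+ i :* d :* ((x₁ :* y₂ :+ :- (x₂ :* y₁)) :+ :- con (pos 0)))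
        refl (a k) (d k) (x k) (y k) x₁ x₂ y₁ y₂ i))))

  proportional-or-spanning : ∀ {a d x y} → Span a d x → Span a d y → ¬ x ≈ 𝟎 →
                             Multiple x y ⊎ (Span x y a × Span x y d)
  proportional-or-spanning {a} {d} {x} {y} (x₁ , x₂ , x≈) (y₁ , y₂ , y≈) x≉0
    with (x₁ * y₂ + - (x₂ * y₁)) ≟ 0ℝ
  ... | no D≢0 = inj₂ (spanning x₁ x₂ y₁ y₂ x≈ y≈ D≢0)
  ... | yes D≡0 with x₁ ≟ 0ℝ | x₂ ≟ 0ℝ
  ...   | no x₁≢0 | _       = inj₁ (proportional x₁ x₂ y₁ y₂ x≈ y≈ D≡0 x₁≢0)
  -- Here the roles of a and d are exchanged, which changes the sign of the determinant.
  ...   | yes _   | no x₂≢0 = inj₁ (proportional x₂ x₁ y₂ y₁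
            (λ k → trans (x≈ k) (+-comm _ _)) (λ k → trans (y≈ k) (+-comm _ _))
            (combine (- 1ℝ) D≡0 (solve 4 (λ x₁ x₂ y₁ y₂ →
              x₂ :* y₁ :+ :- (x₁ :* y₂) := con (pos 0)
                :+ (:- con (pos 1)) :* ((x₁ :* y₂ :+ :- (x₂ :* y₁)) :+ :- con (pos 0)))
              refl x₁ x₂ y₁ y₂))
            x₂≢0)
  ...   | yes refl | yes refl = contradiction
            (λ k → trans (x≈ k) (solve 2 (λ a d →
              con (pos 0) :* a :+ con (pos 0) :* d := con (pos 0)) refl (a k) (d k)))
            x≉0

  ·-cancelʳ-0 : ∀ {c x} → ¬ x ≈ 𝟎 → (c · x) ≈ 𝟎 → c ≡ 0ℝ
  ·-cancelʳ-0 {c} x≉0 cx≈0 with c ≟ 0ℝ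
  ... | yes c≡0 = c≡0
  ... | no  c≢0 = contradiction (λ k → *-cancelˡ-0 c≢0 (cx≈0 k)) x≉0

  -- A nonzero coordinate k of the direction fixes the only possible parameter, and finitely many
  -- equations remain to be tested.
  onLine? : ∀ A x → Dec (OnLine A x)
  onLine? A x with Fin.¬∀⟶∃¬ l (λ k → dir A k ≡ 0ℝ) (λ k → dir A k ≟ 0ℝ) (dir≢0 A)
  ... | k , d≢0 with *-inverse (dir A k) d≢0
  ...   | i , id≡1 with Fin.all? (λ j → x j ≟ (base A j + i * (x k + - base A k) * dir A j))
  ...     | yes x≈ = yes (i * (x k + - base A k) , x≈)
  ...     | no  x≉ = no λ { (t , e) → x≉ λ j →
              combine 1ℝ (e j) (combine (- (i * dir A j)) (e k)
              (combine (- (t * dir A j)) id≡1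
              (solve 8 (λ i t xj bj dj xk bk dk →
                xj := (((bj :+ i :* (xk :+ :- bk) :* dj)
                  :+ con (pos 1) :* (xj :+ :- (bj :+ t :* dj)))
                  :+ (:- (i :* dj)) :* (xk :+ :- (bk :+ t :* dk)))
                  :+ (:- (t :* dj)) :* (i :* dk :+ :- con (pos 1)))
                refl i t (x j) (base A j) (dir A j) (x k) (base A k) (dir A k)))) }

-- Lines seen from O: cones and skewness.

module LinesAndOrigin (R : RealField) (l : ℕ) (O : Geometry.Point R l) where
  open RealField R
  open RealAlgebra R
  open Geometry R l
  open LinearAlgebra R l
  open IsSubspace

  fromO : Point → Point
  fromO x k = x k + - O k

  ⟪_⟫ : Line → PointSet
  ⟪ A ⟫ = Span (fromO (base A)) (dir A)

  cone-isSubspace : ∀ A → IsSubspace ⟪ A ⟫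
  cone-isSubspace A = span-isSubspace (fromO (base A)) (dir A)

  base∈cone : ∀ A → ⟪ A ⟫ (fromO (base A))
  base∈cone A = span-left (fromO (base A)) (dir A)

  dir∈cone : ∀ A → ⟪ A ⟫ (dir A)
  dir∈cone A = span-right (fromO (base A)) (dir A)

  cones-isSubspace : ∀ A B → IsSubspace (⟪ A ⟫ ∔ ⟪ B ⟫)
  cones-isSubspace A B = ∔-isSubspace (cone-isSubspace A) (cone-isSubspace B)

  -- Otherwise A would lie in the span of B seen from O. If `dir A` has no component along the base
  -- vector of B, the lines are parallel; if it has one, they meet.
  skew-¬cone : ∀ A B → Skew A B → ⟪ B ⟫ (fromO (base A)) → ¬ ⟪ B ⟫ (dir A)
  skew-¬cone A B (¬∩ , ¬∥) (α , β , a≈) (γ , δ , d≈) with γ ≟ 0ℝ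
  ... | yes refl = ¬∥ (δ , λ k → trans (d≈ k)
          (solve 3 (λ r d δ → con (pos 0) :* r :+ δ :* d := δ :* d) refl (fromO (base B) k) (dir B k) δ))
  ... | no γ≢0 with *-inverse γ γ≢0
  -- Moving along A by t changes the coefficient of the base vector of B from α to α + t γ. The
  -- choice t = (1 - α) / γ makes it 1, which puts the point on B.
  ...   | i , iγ≡1 = ¬∩ (base A ⊕ (t · dir A) , (t , λ _ → refl) , (β + t * δ , λ k →
          combine 1ℝ (a≈ k) (combine t (d≈ k) (combine ((1ℝ + - α) * fromO (base B) k) iγ≡1
          (solve 10 (λ bA dA bB dB o α β γ δ i →
            bA :+ i :* (con (pos 1) :+ :- α) :* dA :=
              (((bB :+ (β :+ i :* (con (pos 1) :+ :- α) :* δ) :* dB)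
              :+ con (pos 1) :* ((bA :+ :- o) :+ :- (α :* (bB :+ :- o) :+ β :* dB)))
              :+ i :* (con (pos 1) :+ :- α) :* (dA :+ :- (γ :* (bB :+ :- o) :+ δ :* dB)))
              :+ (con (pos 1) :+ :- α) :* (bB :+ :- o) :* (i :* γ :+ :- con (pos 1)))
            refl (base A k) (dir A k) (base B k) (dir B k) (O k) α β γ δ i)))))
    where t = i * (1ℝ + - α)

  -- A relation with s nonzero would give O = `base A` + (t / s) `dir A`, a point of the line.
  off-linIndep : ∀ A → ¬ OnLine A O → LinIndep₂ (fromO (base A)) (dir A)
  off-linIndep A off s t e with s ≟ 0ℝ
  ... | yes refl = refl , ·-cancelʳ-0 (dir≢0 A) (λ k → trans
          (solve 3 (λ t r d → t :* d := con (pos 0) :* r :+ t :* d) refl t (fromO (base A) k) (dir A k))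
          (e k))
  ... | no s≢0 with *-inverse s s≢0
  ...   | i , is≡1 = contradiction (i * t , λ k →
          combine (- i) (e k) (combine (fromO (base A) k) is≡1
          (solve 6 (λ b d o s t i →
            o := ((b :+ i :* t :* d)
              :+ (:- i) :* ((s :* (b :+ :- o) :+ t :* d) :+ :- con (pos 0)))
              :+ (b :+ :- o) :* (i :* s :+ :- con (pos 1)))
            refl (base A k) (dir A k) (O k) s t i)))
          off

  on-cone-⊆ : ∀ A {S} → IsSubspace S → OnLine A O → S (dir A) → ⟪ A ⟫ ⊆ S
  on-cone-⊆ A S (t , e) Sd = span-⊆ S (resp S (λ k → combine (- 1ℝ) (e k)
      (solve 4 (λ b d o t → b :+ :- o := (:- t) :* d
          :+ (:- con (pos 1)) :* (o :+ :- (b :+ t :* d)))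
        refl (base A k) (dir A k) (O k) t)) (scale S (- t) Sd)) Sd

  -- Affine hulls expressed through cones.

  Combination : Line → Line → ℝ → PointSet
  Combination A B w x = ∃[ p ] ∃[ q ] ∃[ s ] ∃[ t ] (p + q ≡ w ×
    x ≈ ((p · base A) ⊕ ((q · base B) ⊕ ((s · dir A) ⊕ (t · dir B)))))

  combination-resp : ∀ A B {w w′ x y} → w′ ≡ w → x ≈ y → Combination A B w′ y → Combination A B w x
  combination-resp A B w′≡w x≈y (p , q , s , t , p+q≡w′ , e) =
    p , q , s , t , trans p+q≡w′ w′≡w , λ k → trans (x≈y k) (e k)

  -- The total weight is a parameter of `Combination` so that it adds up here; the partial sums in
  -- the induction need not have weight 1.
  combination-add : ∀ A B {w w′ x x′} → Combination A B w x → Combination A B w′ x′ →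
                    Combination A B (w + w′) (x ⊕ x′)
  combination-add A B (p , q , s , t , p+q≡w , e) (p′ , q′ , s′ , t′ , p′+q′≡w′ , e′) =
    p + p′ , q + q′ , s + s′ , t + t′ ,
    trans (solve 4 (λ p q p′ q′ → (p :+ p′) :+ (q :+ q′) := (p :+ q) :+ (p′ :+ q′)) refl p q p′ q′)
      (cong₂ _+_ p+q≡w p′+q′≡w′) , λ k →
    trans (cong₂ _+_ (e k) (e′ k))
      (trans (gather p p′ (base A k) _ _) (+-congˡ
      (trans (gather q q′ (base B k) _ _) (+-congˡ
      (trans (gather s s′ (dir A k) _ _) (+-congˡ
        (solve 3 (λ d t t′ → t :* d :+ t′ :* d := (t :+ t′) :* d) refl (dir B k) t t′)))))))
    where
    gather : ∀ p p′ a w w′ → (p * a + w) + (p′ * a + w′) ≡ (p + p′) * a + (w + w′)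
    gather = solve 5 (λ p p′ a w w′ →
      (p :* a :+ w) :+ (p′ :* a :+ w′) := (p :+ p′) :* a :+ (w :+ w′)) refl

  combination-scale : ∀ A B {w x} u → Combination A B w x → Combination A B (u * w) (u · x)
  combination-scale A B u (p , q , s , t , p+q≡w , e) =
    u * p , u * q , u * s , u * t , trans (sym (distribˡ u p q)) (cong (u *_) p+q≡w) , λ k →
    trans (cong (u *_) (e k))
      (trans (pull p (base A k) _) (+-congˡ
      (trans (pull q (base B k) _) (+-congˡ
      (trans (pull s (dir A k) _) (+-congˡ (sym (*-assoc u t (dir B k)))))))))
    where
    pull : ∀ p a w → u * (p * a + w) ≡ u * p * a + u * w
    pull = solve 4 (λ u p a w → u :* (p :* a :+ w) := u :* p :* a :+ u :* w) refl u

  line-combination : ∀ A B {x} → OnLine A x ⊎ OnLine B x → Combination A B 1ℝ x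
  line-combination A B (inj₁ (u , e)) = 1ℝ , 0ℝ , u , 0ℝ , +-identityʳ 1ℝ , λ k → trans (e k)
    (solve 5 (λ a b c d u → a :+ u :* c :=
        con (pos 1) :* a :+ (con (pos 0) :* b :+ (u :* c :+ con (pos 0) :* d)))
      refl (base A k) (base B k) (dir A k) (dir B k) u)
  line-combination A B (inj₂ (u , e)) = 0ℝ , 1ℝ , 0ℝ , u , +-identityˡ 1ℝ , λ k → trans (e k)
    (solve 5 (λ a b c d u → b :+ u :* d :=
        con (pos 0) :* a :+ (con (pos 1) :* b :+ (con (pos 0) :* c :+ u :* d)))
      refl (base A k) (base B k) (dir A k) (dir B k) u)

  sum-combination : ∀ A B {m} (ys : Fin m → Point) (w : Fin m → ℝ) →
    (∀ j → OnLine A (ys j) ⊎ OnLine B (ys j)) →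
    Combination A B (sumℝ w) (sumP (λ j → w j · ys j))
  sum-combination A B {zero} ys w on = 0ℝ , 0ℝ , 0ℝ , 0ℝ , +-identityˡ 0ℝ , λ k →
    solve 4 (λ a b c d → con (pos 0) := con (pos 0) :* a :+ (con (pos 0) :* b :+
      (con (pos 0) :* c :+ con (pos 0) :* d))) refl (base A k) (base B k) (dir A k) (dir B k)
  sum-combination A B {suc m} ys w on = combination-add A B
    (combination-resp A B (*-identityʳ (w zero)) (λ _ → refl)
      (combination-scale A B (w zero) (line-combination A B (on zero))))
    (sum-combination A B (λ j → ys (suc j)) (λ j → w (suc j)) (λ j → on (suc j)))

  hull⇒combination : ∀ A B {x} → AffineHull A B x → Combination A B 1ℝ x
  hull⇒combination A B (m , ys , w , on , Σw≡1 , x≈) with sum-combination A B ys w on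
  ... | p , q , s , t , p+q≡Σw , e =
    p , q , s , t , trans p+q≡Σw Σw≡1 , λ k → trans (x≈ k) (e k)

  -- Four points suffice, those with parameters 0 and 1 on each line. Weights p - s and s on A give
  -- total weight p and direction coefficient s, and likewise q - t and t on B.
  combination⇒hull : ∀ A B {x} → Combination A B 1ℝ x → AffineHull A B x
  combination⇒hull A B {x} (p , q , s , t , p+q≡1 , x≈) = 4 , ys , w , on , Σw≡1 , λ k →
    trans (x≈ k) (solve 8 (λ a b c d p q s t →
        p :* a :+ (q :* b :+ (s :* c :+ t :* d)) :=
        (p :+ :- s) :* (a :+ con (pos 0) :* c) :+ (s :* (a :+ con (pos 1) :* c) :+
        ((q :+ :- t) :* (b :+ con (pos 0) :* d) :+ (t :* (b :+ con (pos 1) :* d) :+ con (pos 0)))))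
      refl (base A k) (base B k) (dir A k) (dir B k) p q s t)
    where
    pattern #0 = zero
    pattern #1 = suc zero
    pattern #2 = suc (suc zero)
    pattern #3 = suc (suc (suc zero))
    ys : Fin 4 → Point
    ys #0 = base A ⊕ (0ℝ · dir A)
    ys #1 = base A ⊕ (1ℝ · dir A)
    ys #2 = base B ⊕ (0ℝ · dir B)
    ys #3 = base B ⊕ (1ℝ · dir B)
    w : Fin 4 → ℝ
    w #0 = p + - s
    w #1 = s
    w #2 = q + - t
    w #3 = t
    on : ∀ j → OnLine A (ys j) ⊎ OnLine B (ys j)
    on #0 = inj₁ (0ℝ , λ _ → refl)
    on #1 = inj₁ (1ℝ , λ _ → refl)
    on #2 = inj₂ (0ℝ , λ _ → refl)
    on #3 = inj₂ (1ℝ , λ _ → refl)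
    Σw≡1 : sumℝ w ≡ 1ℝ
    Σw≡1 = trans (solve 4 (λ p q s t → (p :+ :- s) :+ (s :+ ((q :+ :- t) :+ (t :+ con (pos 0))))
        := p :+ q) refl p q s t) p+q≡1

  -- As the weights total 1, subtracting O from the point amounts to subtracting it from each base.
  hull⇒cones : ∀ A B {x} → AffineHull A B x → (⟪ A ⟫ ∔ ⟪ B ⟫) (fromO x)
  hull⇒cones A B {x} h with hull⇒combination A B h
  ... | p , q , s , t , p+q≡1 , x≈ = _ , _ , (p , s , λ _ → refl) , (q , t , λ _ → refl) , λ k →
    combine 1ℝ (x≈ k) (combine (O k) p+q≡1
      (solve 8 (λ x o a b c d p q →
        x :+ :- o := ((p :* (a :+ :- o) :+ c) :+ (q :* (b :+ :- o) :+ d)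
          :+ con (pos 1) :* (x :+ :- (p :* a :+ (q :* b :+ (c :+ d)))))
          :+ o :* ((p :+ q) :+ :- con (pos 1)))
        refl (x k) (O k) (base A k) (base B k) (s * dir A k) (t * dir B k) p q))

  cones⇒hull : ∀ A B {x} → AffineHull A B O → (⟪ A ⟫ ∔ ⟪ B ⟫) (fromO x) → AffineHull A B x
  cones⇒hull A B {x} h (y , z , (α , β , y≈) , (γ , δ , z≈) , x≈) = combination⇒hull A B
    (combination-resp A B
      (solve 2 (λ α γ → (con (pos 1) :+ :- (α :+ γ)) :* con (pos 1) :+ (α :+ γ) := con (pos 1)) refl α γ)
      (λ k → combine 1ℝ (trans (x≈ k) (cong₂ _+_ (y≈ k) (z≈ k)))
        (solve 8 (λ x o a b c d α γ →
          x := ((con (pos 1) :+ :- (α :+ γ)) :* o :+ (α :* a :+ (γ :* b :+ (c :+ d))))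
            :+ con (pos 1) :* ((x :+ :- o) :+ :- ((α :* (a :+ :- o) :+ c) :+ (γ :* (b :+ :- o) :+ d))))
          refl (x k) (O k) (base A k) (base B k) (β * dir A k) (δ * dir B k) α γ))
      -- The coefficients α and γ need not total 1; O, itself a point of the hull, takes the missing
      -- weight 1 - (α + γ).
      (combination-add A B (combination-scale A B (1ℝ + - (α + γ)) (hull⇒combination A B h))
        (α , γ , β , δ , refl , λ _ → refl)))

  -- The linear dependence between the two cones that expresses O in the hull. The condition p + q =
  -- 1 keeps it nontrivial.
  record Relation (A B : Line) : Set where
    constructor relation
    field
      p q s t : ℝ
      p+q≡1   : p + q ≡ 1ℝ
      vanish  : (((p · fromO (base A)) ⊕ (s · dir A)) ⊕ ((q · fromO (base B)) ⊕ (t · dir B))) ≈ 𝟎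

  hull⇒relation : ∀ A B → AffineHull A B O → Relation A B
  hull⇒relation A B h with hull⇒combination A B h
  ... | p , q , s , t , p+q≡1 , O≈ = relation p q s t p+q≡1 λ k →
    combine (- 1ℝ) (O≈ k) (combine (- O k) p+q≡1
      (solve 7 (λ o a b c d p q →
        (p :* (a :+ :- o) :+ c) :+ (q :* (b :+ :- o) :+ d) :=
          (con (pos 0) :+ (:- con (pos 1)) :* (o :+ :- (p :* a :+ (q :* b :+ (c :+ d)))))
          :+ (:- o) :* ((p :+ q) :+ :- con (pos 1)))
        refl (O k) (base A k) (base B k) (s * dir A k) (t * dir B k) p q))

  negate : ∀ v b d q t → v + (q * b + t * d) ≡ 0ℝ → v ≡ - q * b + - t * d
  negate v b d q t e = combine 1ℝ e (solve 5 (λ v b d q t →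
      v := ((:- q) :* b :+ (:- t) :* d)
        :+ con (pos 1) :* ((v :+ (q :* b :+ t :* d)) :+ :- con (pos 0)))
    refl v b d q t)

  -- The A-part v of the relation is minus its B-part, so it lies in both cones. If it vanished, so
  -- would the B-part, and independence would give p = q = 0 against p + q = 1.
  cones-meet : ∀ A B → Relation A B → ¬ OnLine A O → ¬ OnLine B O →
               ∃[ v ] (¬ v ≈ 𝟎 × ⟪ A ⟫ v × ⟪ B ⟫ v)
  cones-meet A B (relation p q s t p+q≡1 e) offA offB = v , v≉0 , (p , s , λ _ → refl) ,
    (- q , - t , λ k → negate (v k) (fromO (base B) k) (dir B k) q t (e k))
    where
    v : Point
    v = (p · fromO (base A)) ⊕ (s · dir A)
    v≉0 : ¬ v ≈ 𝟎
    v≉0 v≈0 = 0≢1 (trans (sym (trans (cong₂ _+_ p≡0 q≡0) (+-identityˡ 0ℝ))) p+q≡1)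
      where
      p≡0 : p ≡ 0ℝ
      p≡0 = proj₁ (off-linIndep A offA p s v≈0)
      rest : Point
      rest = (q · fromO (base B)) ⊕ (t · dir B)
      rest≈0 : rest ≈ 𝟎
      rest≈0 k = trans (sym (+-identityˡ (rest k))) (trans (cong (_+ rest k) (sym (v≈0 k))) (e k))
      q≡0 : q ≡ 0ℝ
      q≡0 = proj₁ (off-linIndep B offB q t rest≈0)

  -- Two independent common vectors would span the cone of A and so place it inside the cone of B.
  cones-meet-unique : ∀ A B {x y} → Skew A B → ⟪ A ⟫ x → ⟪ B ⟫ x → ⟪ A ⟫ y → ⟪ B ⟫ y →
                      ¬ x ≈ 𝟎 → Multiple x y
  cones-meet-unique A B sk Ax Bx Ay By x≉0 with proportional-or-spanning Ax Ay x≉0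
  ... | inj₁ y∥x       = y∥x
  ... | inj₂ (xy∋a , xy∋d) =
    contradiction (xy⊆B _ xy∋d) (skew-¬cone A B sk (xy⊆B _ xy∋a))
    where xy⊆B = span-⊆ (cone-isSubspace B) Bx By

  line-⊆-hull : ∀ A B F → OnLine F ⊆ AffineHull A B → ⟪ F ⟫ ⊆ (⟪ A ⟫ ∔ ⟪ B ⟫)
  line-⊆-hull A B F F⊆ = span-⊆ S Sb (resp S
      (λ k → solve 3 (λ b d o → d := ((b :+ con (pos 1) :* d) :+ :- o) :+ (:- con (pos 1)) :* (b :+ :- o))
        refl (base F k) (dir F k) (O k))
      (add S Sb+d (scale S (- 1ℝ) Sb)))
    where
    S = cones-isSubspace A B
    Sb = hull⇒cones A B (F⊆ (base F) (0ℝ , λ k →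
      solve 2 (λ b d → b := b :+ con (pos 0) :* d) refl (base F k) (dir F k)))
    Sb+d = hull⇒cones A B (F⊆ (base F ⊕ (1ℝ · dir F)) (1ℝ , λ _ → refl))

  -- The hull is three-dimensional, so modulo the plane ⟪ A ⟫ one further vector generates it.
  generator : ∀ A B → Relation A B → ¬ OnLine A O →
              ∃[ z ] (∀ {S} → IsSubspace S → ⟪ A ⟫ ⊆ S → S z → ⟪ B ⟫ ⊆ S)
  generator A B (relation p q s t p+q≡1 e) offA with q ≟ 0ℝ
  -- The relation eliminates whichever vector of B has a nonzero coefficient; the other one
  -- generates.
  ... | no q≢0 = dir B , λ S A⊆S Sd → span-⊆ S
            (cancel-summand q S q≢0 (origin S)
              (add S (A⊆S _ (p , s , λ _ → refl)) (scale S t Sd))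
              (λ k → trans (sym (e k)) (solve 4 (λ v q b w → v :+ (q :* b :+ w) := (v :+ w) :+ q :* b)
                refl (p * fromO (base A) k + s * dir A k) q (fromO (base B) k) (t * dir B k))))
            Sd
  ... | yes refl = fromO (base B) , λ S A⊆S Sb → span-⊆ S Sb
            (cancel-summand t S t≢0 (origin S) (A⊆S _ (p , s , λ _ → refl))
              (λ k → trans (sym (e k)) (drop-b k)))
    where
    drop-b : ∀ k → (p * fromO (base A) k + s * dir A k) + (0ℝ * fromO (base B) k + t * dir B k)
                   ≡ (p * fromO (base A) k + s * dir A k) + t * dir B k
    drop-b k = solve 3 (λ v b w → v :+ (con (pos 0) :* b :+ w) := v :+ w)
      refl (p * fromO (base A) k + s * dir A k) (fromO (base B) k) (t * dir B k)
    t≢0 : t ≢ 0ℝ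
    -- With q = t = 0 independence in the cone of A gives p = 0, while p + q = 1 gives p = 1.
    t≢0 refl = 0≢1 (trans (sym (proj₁ (off-linIndep A offA p s λ k →
        trans (solve 2 (λ v d → v := v :+ con (pos 0) :* d)
          refl (p * fromO (base A) k + s * dir A k) (dir B k))
        (trans (sym (drop-b k)) (e k)))))
      (trans (sym (+-identityʳ p)) p+q≡1))

  -- Steinitz exchange modulo the cone of A. The cone of F lies in that of A plus the multiples of
  -- z; by skewness some vector of F has a nonzero z-part, so z is recovered from A and F, and z
  -- generates B.
  exchange : ∀ A B F → Relation A B → ¬ OnLine A O → Skew F A →
             ⟪ F ⟫ ⊆ (⟪ A ⟫ ∔ ⟪ B ⟫) → ⟪ B ⟫ ⊆ (⟪ A ⟫ ∔ ⟪ F ⟫)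
  exchange A B F rel offA sk F⊆ = from-generator (generator A B rel offA)
    where
    AF = cones-isSubspace A F
    A⊆AF = ⊆-∔ˡ (cone-isSubspace F)
    F⊆AF = ⊆-∔ʳ (cone-isSubspace A)
    Generator = ∃[ z ] (∀ {S} → IsSubspace S → ⟪ A ⟫ ⊆ S → S z → ⟪ B ⟫ ⊆ S)
    from-generator : Generator → ⟪ B ⟫ ⊆ (⟪ A ⟫ ∔ ⟪ F ⟫)
    from-generator (z , generates) =
      generates AF A⊆AF (conclude (reach (base∈cone F)) (reach (dir∈cone F)))
      where
      Az : IsSubspace (⟪ A ⟫ ∔ Multiple z)
      Az = ∔-isSubspace (cone-isSubspace A) (multiple-isSubspace z)
      A⊆Az = ⊆-∔ˡ (multiple-isSubspace z)
      F⊆Az : ⟪ F ⟫ ⊆ (⟪ A ⟫ ∔ Multiple z)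
      F⊆Az x Fx = ∔-⊆ Az A⊆Az
        (generates Az A⊆Az (⊆-∔ʳ (cone-isSubspace A) z (multiple-self z))) x (F⊆ x Fx)
      reach : ∀ {x} → ⟪ F ⟫ x → (⟪ A ⟫ ∔ ⟪ F ⟫) z ⊎ ⟪ A ⟫ x
      reach {x} Fx = recover-or-drop (cone-isSubspace A) AF A⊆AF (F⊆AF x Fx) (F⊆Az x Fx)
      conclude : (⟪ A ⟫ ∔ ⟪ F ⟫) z ⊎ ⟪ A ⟫ (fromO (base F)) → (⟪ A ⟫ ∔ ⟪ F ⟫) z ⊎ ⟪ A ⟫ (dir F) →
                 (⟪ A ⟫ ∔ ⟪ F ⟫) z
      conclude (inj₁ AFz) _          = AFz
      conclude (inj₂ _)   (inj₁ AFz) = AFz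
      conclude (inj₂ Ab)  (inj₂ Ad)  = contradiction Ad (skew-¬cone F A sk Ab)

  -- The line through O in a given direction.

  through : (v : Point) → ¬ v ≈ 𝟎 → Line
  through v v≉0 = line O v v≉0

  through-O : ∀ v v≉0 → OnLine (through v v≉0) O
  through-O v _ = 0ℝ , λ k → solve 2 (λ o v → o := o :+ con (pos 0) :* v) refl (O k) (v k)

  through-⊆⇒multiple : ∀ A {v} v≉0 → OnLine (through v v≉0) ⊆ OnLine A → Multiple (dir A) v
  through-⊆⇒multiple A {v} v≉0 M⊆A = difference
      (M⊆A O (through-O v v≉0)) (M⊆A (O ⊕ (1ℝ · v)) (1ℝ , λ _ → refl))
    where
    difference : OnLine A O → OnLine A (O ⊕ (1ℝ · v)) → Multiple (dir A) v
    difference (s , e) (t , e′) = t + - s , λ k → combine 1ℝ (e′ k) (combine (- 1ℝ) (e k)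
      (solve 6 (λ o v b d s t → v := ((t :+ :- s) :* d
          :+ con (pos 1) :* ((o :+ con (pos 1) :* v) :+ :- (b :+ t :* d)))
          :+ (:- con (pos 1)) :* (o :+ :- (b :+ s :* d)))
        refl (O k) (v k) (base A k) (dir A k) s t))

  -- The common plane is O plus the cone of A; A itself is where the first parameter equals 1.
  coplanar-off : ∀ A {v} v≉0 → ¬ OnLine A O → ⟪ A ⟫ v → Coplanar A (through v v≉0)
  coplanar-off A {v} v≉0 off (α , β , v≈) =
    O , fromO (base A) , dir A , off-linIndep A off ,
    (λ x → λ { (t , e) → 1ℝ , t , λ k → trans (e k)
      (solve 4 (λ b d o t → b :+ t :* d := (o :+ con (pos 1) :* (b :+ :- o)) :+ t :* d)
        refl (base A k) (dir A k) (O k) t) }) ,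
    (λ x → λ { (t , e) → t * α , t * β , λ k → trans (e k) (trans (cong (λ y → O k + t * y) (v≈ k))
      (solve 6 (λ r d o t α β → o :+ t :* (α :* r :+ β :* d) := (o :+ t :* α :* r) :+ t :* β :* d)
        refl (fromO (base A) k) (dir A k) (O k) t α β)) })

  coplanar-on : ∀ A {v} v≉0 → OnLine A O → ¬ Multiple (dir A) v → Coplanar A (through v v≉0)
  coplanar-on A {v} v≉0 (t₀ , O≈) ¬∥ =
    O , dir A , v , linIndep ,
    (λ x → λ { (t , e) → t + - t₀ , 0ℝ , λ k → trans (e k) (combine (- 1ℝ) (O≈ k)
      (solve 6 (λ b d o v t t₀ → b :+ t :* d :=
          ((o :+ (t :+ :- t₀) :* d) :+ con (pos 0) :* v)
          :+ (:- con (pos 1)) :* (o :+ :- (b :+ t₀ :* d)))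
        refl (base A k) (dir A k) (O k) (v k) t t₀)) }) ,
    (λ x → λ { (t , e) → 0ℝ , t , λ k → trans (e k)
      (solve 4 (λ d o v t → o :+ t :* v := (o :+ con (pos 0) :* d) :+ t :* v)
        refl (dir A k) (O k) (v k) t) })
    where
    linIndep : LinIndep₂ (dir A) v
    linIndep s t e with t ≟ 0ℝ
    ... | yes refl = ·-cancelʳ-0 (dir≢0 A) (λ k → trans
            (solve 3 (λ s d v → s :* d := s :* d :+ con (pos 0) :* v) refl s (dir A k) (v k)) (e k)) , refl
    ... | no t≢0 with *-inverse t t≢0
    ...   | i , it≡1 = contradiction (- (i * s) , λ k → combine i (e k) (combine (- v k) it≡1
            (solve 5 (λ d v s t i → v := ((:- (i :* s)) :* d
                :+ i :* ((s :* d :+ t :* v) :+ :- con (pos 0)))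
                :+ (:- v) :* (i :* t :+ :- con (pos 1)))
              refl (dir A k) (v k) s t i))) ¬∥

  -- Families of skew lines whose hulls all contain O.

  module Configuration {n : ℕ} (L : Fin n → Line)
    (skew : ∀ i j → i ≢ j → Skew (L i) (L j))
    (third : ∀ i j → i ≢ j → ∃[ k ] (k ≢ i × k ≢ j × (OnLine (L k) ⊆ AffineHull (L i) (L j))))
    (O∈hull : ∀ i j → i ≢ j → AffineHull (L i) (L j) O)
    where

    P : Fin n → PointSet
    P i = ⟪ L i ⟫

    Off : Fin n → Set
    Off i = ¬ OnLine (L i) O

    P-isSubspace : ∀ i → IsSubspace (P i)
    P-isSubspace i = cone-isSubspace (L i)

    PP-isSubspace : ∀ i j → IsSubspace (P i ∔ P j)
    PP-isSubspace i j = cones-isSubspace (L i) (L j)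

    ⊆-left : ∀ i j → P i ⊆ (P i ∔ P j)
    ⊆-left i j = ⊆-∔ˡ (P-isSubspace j)

    ⊆-right : ∀ i j → P j ⊆ (P i ∔ P j)
    ⊆-right i j = ⊆-∔ʳ (P-isSubspace i)

    rel : ∀ i j → i ≢ j → Relation (L i) (L j)
    rel i j i≢j = hull⇒relation (L i) (L j) (O∈hull i j i≢j)

    on⇒off : ∀ {i j} → i ≢ j → OnLine (L i) O → Off j
    on⇒off {i} {j} i≢j O∈i O∈j = proj₁ (skew i j i≢j) (O , O∈i , O∈j)

    -- Let the cone of m meet those of j and k in x and y. If they are proportional, y is common to
    -- j and k, hence proportional to v, and v lies in the cone of m. Otherwise x and y span that
    -- cone, which puts it in the sum.
    contains-or-within : ∀ {j k m v} → j ≢ k → m ≢ j → m ≢ k → Off j → Off k → Off m →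
      P j v → P k v → ¬ v ≈ 𝟎 → P m v ⊎ (¬ P m v × P m ⊆ (P j ∔ P k))
    contains-or-within {j} {k} {m} {v} j≢k m≢j m≢k offj offk offm jv kv v≉0 =
      meeting (cones-meet (L m) (L j) (rel m j m≢j) offm offj)
              (cones-meet (L m) (L k) (rel m k m≢k) offm offk)
      where
      meeting : ∃[ x ] (¬ x ≈ 𝟎 × P m x × P j x) → ∃[ y ] (¬ y ≈ 𝟎 × P m y × P k y) →
                P m v ⊎ (¬ P m v × P m ⊆ (P j ∔ P k))
      meeting (x , x≉0 , mx , jx) (y , y≉0 , my , ky) =
        [ (λ x∥y → inj₁ (contains x∥y)) , (λ { (b , d) → inj₂ (avoids b d , within b d) }) ]′
          (proportional-or-spanning mx my x≉0)
        where
        contains : Multiple x y → P m v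
        contains x∥y = multiple-⊆ (P-isSubspace m) my v
          (cones-meet-unique (L j) (L k) (skew j k j≢k)
            (multiple-⊆ (P-isSubspace j) jx y x∥y) ky jv kv y≉0)
        within : Span x y (fromO (base (L m))) → Span x y (dir (L m)) → P m ⊆ (P j ∔ P k)
        within b d = span-⊆ (PP-isSubspace j k) (xy⊆ _ b) (xy⊆ _ d)
          where xy⊆ = span-⊆ (PP-isSubspace j k) (⊆-left j k x jx) (⊆-right j k y ky)
        avoids : Span x y (fromO (base (L m))) → Span x y (dir (L m)) → ¬ P m v
        -- If v were in the cone of m, y would be a multiple of v and so lie in the cone of j; then
        -- x and y would put the whole cone of m there.
        avoids b d mv = skew-¬cone (L m) (L j) (skew m j m≢j) (xy⊆ _ b) (xy⊆ _ d)
          where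
          jy = multiple-⊆ (P-isSubspace j) jv y
            (cones-meet-unique (L m) (L k) (skew m k m≢k) mv kv my ky v≉0)
          xy⊆ = span-⊆ (P-isSubspace j) jx jy

    -- The case where v lies in the cone of every line missing O.

    module Concurrent {j v} (offj : Off j) (jv : P j v) (v≉0 : ¬ v ≈ 𝟎)
      (concurrent : ∀ m → Off m → P m v) where

      -- Otherwise the cone of m, being the multiples of its direction, would consist of multiples
      -- of v and lie in the cone of j, against skewness.
      dir-¬multiple : ∀ m → OnLine (L m) O → ¬ Multiple (dir (L m)) v
      dir-¬multiple m O∈m d∥v = skew-¬cone (L m) (L j) (skew m j m≢j)
          (m⊆j _ (base∈cone (L m))) (m⊆j _ (dir∈cone (L m)))
        where
        m≢j : m ≢ j
        m≢j refl = offj O∈m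
        m⊆j : P m ⊆ P j
        m⊆j = on-cone-⊆ (L m) (P-isSubspace j) O∈m
          (multiple-⊆ (P-isSubspace j) jv _ (multiple-sym v≉0 d∥v))

      transversal : ∃[ M ] (OnLine M O × (∀ i → ¬ (OnLine M ≐ OnLine (L i))) × (∀ i → Coplanar (L i) M))
      transversal = through v v≉0 , through-O v v≉0 ,
        (λ { m (M⊆m , _) → dir-¬multiple m (M⊆m O (through-O v v≉0))
               (through-⊆⇒multiple (L m) v≉0 M⊆m) }) ,
        (λ m → case onLine? (L m) O of λ
          { (yes O∈m) → coplanar-on (L m) v≉0 O∈m (dir-¬multiple m O∈m)
          ; (no offm) → coplanar-off (L m) v≉0 offm (concurrent m offm) })

    -- The case where the cone of some line m₀ missing O avoids v.

    module Planar {j k m₀ v} (j≢k : j ≢ k) (m₀≢j : m₀ ≢ j) (offj : Off j) (offk : Off k) (offm₀ : Off m₀)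
      (jv : P j v) (kv : P k v) (v≉0 : ¬ v ≈ 𝟎) (¬m₀v : ¬ P m₀ v) (m₀⊆ : P m₀ ⊆ (P j ∔ P k)) where

      -- If the cone of m contains v, the dichotomy is applied again to the pair j, m₀ with common
      -- vector w. Were w also in the cone of m, then v and w, both common to m and j, would be
      -- proportional, and v would lie in the cone of m₀.
      off-⊆ : ∀ m → Off m → P m ⊆ (P j ∔ P k)
      off-⊆ m offm = case (m Fin.≟ j) ,′ (m Fin.≟ k) ,′ (m Fin.≟ m₀) of λ
        { (yes refl , _ , _)            → ⊆-left j k
        ; (_ , yes refl , _)            → ⊆-right j k
        ; (_ , _ , yes refl)            → m₀⊆
        ; (no m≢j , no m≢k , no m≢m₀) →
            [ (λ mv → via-m₀ m≢j m≢m₀ mv (cones-meet (L j) (L m₀) (rel j m₀ (≢-sym m₀≢j)) offj offm₀)) , proj₂ ]′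
              (contains-or-within j≢k m≢j m≢k offj offk offm jv kv v≉0)
        }
        where
        via-m₀ : m ≢ j → m ≢ m₀ → P m v → ∃[ w ] (¬ w ≈ 𝟎 × P j w × P m₀ w) → P m ⊆ (P j ∔ P k)
        via-m₀ m≢j m≢m₀ mv (w , w≉0 , jw , m₀w) =
          [ (λ mw → contradiction (multiple-⊆ (P-isSubspace m₀) m₀w v
                (cones-meet-unique (L m) (L j) (skew m j m≢j) mw jw mv jv w≉0)) ¬m₀v)
          , (λ { (_ , m⊆) x mx → ∔-⊆ (PP-isSubspace j k) (⊆-left j k) m₀⊆ x (m⊆ x mx) }) ]′
            (contains-or-within (≢-sym m₀≢j) m≢j m≢m₀ offj offm₀ offm jw m₀w w≉0)

      -- The third line p in the hull of j and m misses O, so `off-⊆` applies to it, and exchanging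
      -- m for p bounds the cone of m.
      on-⊆ : ∀ m → OnLine (L m) O → P m ⊆ (P j ∔ P k)
      on-⊆ m O∈m = λ x mx → ∔-⊆ (PP-isSubspace j k) (⊆-left j k) (off-⊆ p offp) x (m⊆ x mx)
        where
        j≢m : j ≢ m
        j≢m refl = offj O∈m
        p = proj₁ (third j m j≢m)
        p≢j = proj₁ (proj₂ (third j m j≢m))
        p≢m = proj₁ (proj₂ (proj₂ (third j m j≢m)))
        offp = on⇒off (≢-sym p≢m) O∈m
        m⊆ : P m ⊆ (P j ∔ P p)
        m⊆ = exchange (L j) (L m) (L p) (rel j m j≢m) offj (skew p j p≢j)
          (line-⊆-hull (L j) (L m) (L p) (proj₂ (proj₂ (proj₂ (third j m j≢m)))))

      all-⊆ : ∀ m → P m ⊆ (P j ∔ P k)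
      all-⊆ m = case onLine? (L m) O of λ { (yes O∈m) → on-⊆ m O∈m ; (no offm) → off-⊆ m offm }

      ⊆-jm : ∀ {m} → m ≢ j → (P j ∔ P k) ⊆ (P j ∔ P m)
      ⊆-jm {m} m≢j = ∔-⊆ (PP-isSubspace j m) (⊆-left j m)
        (exchange (L j) (L k) (L m) (rel j k j≢k) offj (skew m j m≢j) (all-⊆ m))

      -- The pair is replaced in two exchanges, from (j, k) to (j, a) to (a, b). Each keeps a line
      -- missing O, first j and then a.
      ⊆-off-first : ∀ {a b} → Off a → a ≢ b → (P j ∔ P k) ⊆ (P a ∔ P b)
      ⊆-off-first {a} {b} offa a≢b = case a Fin.≟ j of λ
        { (yes refl) → ⊆-jm (≢-sym a≢b)
        ; (no a≢j)   →
            let b⊆aj x bx = ∔-⊆ (PP-isSubspace a j) (⊆-right a j) (⊆-left a j) x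
                              (⊆-jm a≢j x (all-⊆ b x bx))
                j⊆ab = exchange (L a) (L j) (L b) (rel a j a≢j) offa (skew b a (≢-sym a≢b)) b⊆aj
            in λ x hx → ∔-⊆ (PP-isSubspace a b) j⊆ab (⊆-left a b) x (⊆-jm a≢j x hx)
        }

      ⊆-pair : ∀ {a b} → a ≢ b → (P j ∔ P k) ⊆ (P a ∔ P b)
      ⊆-pair {a} {b} a≢b = case onLine? (L a) O of λ
        { (no offa) → ⊆-off-first offa a≢b
        ; (yes O∈a) → λ x hx → ∔-⊆ (PP-isSubspace a b) (⊆-right a b) (⊆-left a b) x
            (⊆-off-first (on⇒off a≢b O∈a) (≢-sym a≢b) x hx)
        }

      hull-⊆ : ∀ {a b c d} → a ≢ b → c ≢ d → AffineHull (L a) (L b) ⊆ AffineHull (L c) (L d)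
      hull-⊆ {a} {b} {c} {d} a≢b c≢d x h = cones⇒hull (L c) (L d) (O∈hull c d c≢d)
        (⊆-pair c≢d _ (∔-⊆ (PP-isSubspace j k) (all-⊆ a) (all-⊆ b) _ (hull⇒cones (L a) (L b) h)))

    -- At most one line passes through O; if i or j does, the third line in their hull takes its
    -- place.
    two-off : ∀ {i j} → i ≢ j → ∃[ a ] ∃[ b ] (a ≢ b × Off a × Off b)
    two-off {i} {j} i≢j = case onLine? (L i) O ,′ onLine? (L j) O ,′ third i j i≢j of λ
      { (yes O∈i , _ , k , k≢i , k≢j , _)       → j , k , ≢-sym k≢j , on⇒off i≢j O∈i , on⇒off (≢-sym k≢i) O∈i
      ; (no offi , yes O∈j , k , k≢i , k≢j , _) → i , k , ≢-sym k≢i , offi , on⇒off (≢-sym k≢j) O∈j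
      ; (no offi , no offj , _)                 → i , j , i≢j , offi , offj
      }

    -- Conclusion from two distinct hulls.

    module _ {a b c d} (a≢b : a ≢ b) (c≢d : c ≢ d)
      (distinct : ¬ (AffineHull (L a) (L b) ≐ AffineHull (L c) (L d))) where

      transversal : ∃[ M ] (OnLine M O × (∀ i → ¬ (OnLine M ≐ OnLine (L i))) × (∀ i → Coplanar (L i) M))
      transversal = choose (two-off a≢b)
        where
        choose : ∃[ j ] ∃[ k ] (j ≢ k × Off j × Off k) → _
        choose (j , k , j≢k , offj , offk) = meeting (cones-meet (L j) (L k) (rel j k j≢k) offj offk)
          where
          meeting : ∃[ v ] (¬ v ≈ 𝟎 × P j v × P k v) → _
          meeting (v , v≉0 , jv , kv) = [ Concurrent.transversal offj jv v≉0 , planar ]′ (all-or-any classify)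
            where
            Exceptional : Fin n → Set
            Exceptional m = m ≢ j × Off m × ¬ P m v × P m ⊆ (P j ∔ P k)
            classify : ∀ m → (Off m → P m v) ⊎ Exceptional m
            classify m = case onLine? (L m) O ,′ (m Fin.≟ j) ,′ (m Fin.≟ k) of λ
              { (yes O∈m , _ , _)            → inj₁ (contradiction O∈m)
              ; (_ , yes refl , _)           → inj₁ λ _ → jv
              ; (_ , _ , yes refl)           → inj₁ λ _ → kv
              ; (no offm , no m≢j , no m≢k) →
                  [ (λ mv → inj₁ λ _ → mv) , (λ { (¬mv , m⊆) → inj₂ (m≢j , offm , ¬mv , m⊆) }) ]′
                    (contains-or-within j≢k m≢j m≢k offj offk offm jv kv v≉0)
              }
            planar : ∃ Exceptional → _
            -- An exceptional line would make every two hulls equal, contrary to the two distinct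
            -- ones given.
            planar (m₀ , m₀≢j , offm₀ , ¬m₀v , m₀⊆) = contradiction (hull-⊆ a≢b c≢d , hull-⊆ c≢d a≢b) distinct
              where open Planar j≢k m₀≢j offj offk offm₀ jv kv v≉0 ¬m₀v m₀⊆

mainTheorem7 : (R : RealField) (l : ℕ) → 4 ≤ l →
    let open Geometry R l in
    (n : ℕ) (L : Fin n → Line) →
    (∀ i j → i ≢ j → Skew (L i) (L j)) →
    (∀ i j → i ≢ j → ∃[ k ] (k ≢ i × k ≢ j × (OnLine (L k) ⊆ AffineHull (L i) (L j)))) →
    (∃[ i ] ∃[ j ] ∃[ k ] ∃[ k′ ] (i ≢ j × k ≢ k′ × ¬ (AffineHull (L i) (L j) ≐ AffineHull (L k) (L k′)))) →
    (O : Point) →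
    (∀ i j → i ≢ j → AffineHull (L i) (L j) O) →
    ∃[ M ] (OnLine M O × (∀ i → ¬ (OnLine M ≐ OnLine (L i))) × (∀ i → Coplanar (L i) M))
mainTheorem7 R l _ n L skew third (i , j , k , k′ , i≢j , k≢k′ , distinct) O O∈hull =
  LinesAndOrigin.Configuration.transversal R l O L skew third O∈hull i≢j k≢k′ distinct
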